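{- Let $W$ be a finite Coxeter group and let $\Phi^+(W)$ be its set of positive roots. The maximal number of colors used in a transitive coloring of $\Phi^+(W)$ is equal to the rank of $W$.
   Context: The rank of a Coxeter group is its number of Coxeter (simple) generators; $\Phi^+(W)$ is the set of positive roots of the root system of $W$, viewed as a finite set of vectors in the real geometric representation. A transitive coloring of a finite set $E$ of vectors in a real vector space is a function $\varepsilon$ from $E$ to a set of colors such that for any two disjoint (nonempty) subsets $S,T\subseteq E$: if $\operatorname{span}_{\mathbb{R}_{>0}}(S)\cap\operatorname{span}_{\mathbb{R}_{>0}}(T)\neq\varnothing$ then $\varepsilon(S)\cap\varepsilon(T)\neq\varnothing$, where $\operatorname{span}_{\mathbb{R}_{>0}}(S)$ is the set of linear combinations of all elements of $S$ with strictly positive coefficients. Equivalently, it is a coloring such that for every signed circuit $(X^+,X^-)$ of the oriented matroid of linear dependencies of $E$, $\varepsilon(X^+)\cap\varepsilon(X^-)\neq\varnothing$. The number of colors used is $|\varepsilon(E)|$. -}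

module Defs where

open import Algebra.Bundles using (CommutativeRing; Group; Semiring)
open import Algebra.Module.Bundles using (Module)
import Algebra.Definitions.RawMonoid as RawMonoidDefs
import Algebra.Definitions.RawSemiring as RawSemiringDefs
open import Data.Bool.Base using (if_then_else_)
open import Data.Fin.Base using (Fin; toℕ)
open import Data.Fin.Properties using (_≟_)
open import Data.List.Base using (List; []; _∷_; _++_; concat; foldr; length; lookup; map; replicate)
import Data.List.Membership.Setoid as Membership
import Data.List.Relation.Binary.Disjoint.Setoid as DisjointLists
import Data.List.Relation.Unary.Unique.Setoid as UniqueLists
open import Data.Nat.Base as ℕ using (ℕ; _!)
open import Data.Product.Base using (Σ; Σ-syntax; ∃; ∃-syntax; _×_; _,_; proj₁)
open import Data.Vec.Functional using (Vector)
open import Function.Bundles using (Bijection; Func; _⇔_; _⟶ₛ_)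
open import Function.Definitions using (Injective)
open import Level using (Level; _⊔_; 0ℓ) renaming (suc to lsuc)
import Relation.Binary.Construct.On as On
import Relation.Binary.Construct.StrictToNonStrict as StrictToNonStrict
open import Relation.Binary.Bundles using (Setoid)
open import Relation.Binary.Core using (Rel)
open import Relation.Binary.Construct.Closure.Equivalence using (EqClosure)
open import Relation.Binary.PropositionalEquality using (_≡_; _≢_)
import Relation.Binary.PropositionalEquality.Properties as ≡
open import Relation.Binary.Structures using (IsStrictTotalOrder)
open import Relation.Nullary using (¬_; does)
open import Relation.Unary using (Pred; Satisfiable)

private
  variable
    a c ℓ : Level

IsMaximum : Pred ℕ ℓ → ℕ → Set ℓ
IsMaximum P m = P m × (∀ k → P k → k ℕ.≤ m)

Finite : Setoid c ℓ → Set (c ⊔ ℓ)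
Finite S = ∃[ N ] Bijection S (≡.setoid (Fin N))

------------------------------------------------------------------------
-- The real numbers

-- The library has no real numbers; they are axiomatised, as usual in
-- classical mathematics, as a Dedekind-complete ordered field.  These
-- axioms determine ℝ up to unique isomorphism.  The strict order is
-- trichotomous, so comparisons of reals are decidable.

record RealNumbers : Set₁ where
  infix 4 _<_
  infix 8 _⁻¹
  field
    commutativeRing : CommutativeRing 0ℓ 0ℓ

  open CommutativeRing commutativeRing public
    renaming (Carrier to ℝ)

  field
    _<_                : Rel ℝ 0ℓ
    isStrictTotalOrder : IsStrictTotalOrder _≈_ _<_
    0<1                : 0# < 1#
    +-monoˡ-<          : ∀ {x y} z → x < y → x + z < y + z
    *-pos              : ∀ {x y} → 0# < x → 0# < y → 0# < x * y

    -- The value of 0# ⁻¹ is left unspecified.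
    _⁻¹                : ℝ → ℝ
    ⁻¹-cong            : ∀ {x y} → x ≈ y → x ⁻¹ ≈ y ⁻¹
    ⁻¹-inverseʳ        : ∀ {x} → ¬ (x ≈ 0#) → x * x ⁻¹ ≈ 1#

  open StrictToNonStrict _≈_ _<_ public using (_≤_)

  UpperBound : Pred ℝ 0ℓ → ℝ → Set
  UpperBound P b = ∀ x → P x → x ≤ b

  field
    supremum : (P : Pred ℝ 0ℓ) → Satisfiable P → ∃ (UpperBound P) →
               ∃[ s ] UpperBound P s × (∀ b → UpperBound P b → s ≤ b)

  open RawMonoidDefs +-rawMonoid public
    using (sum) renaming (_×_ to _·_)
  open RawSemiringDefs (Semiring.rawSemiring semiring) public using (_^_)

module Cosine (R : RealNumbers) where
  open RealNumbers R

  cosTerm : ℝ → ℕ → ℝ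
  cosTerm x k = (- 1#) ^ k * x ^ (2 ℕ.* k) * (((2 ℕ.* k) !) · 1#) ⁻¹

  -- y ≈ cos x: the power series Σₖ (-1)ᵏ x²ᵏ / (2k)! converges to y.
  IsCos : ℝ → ℝ → Set
  IsCos x y = ∀ δ → 0# < δ → ∃[ N ] ∀ n → N ℕ.≤ n →
    let d = sum {n} (λ k → cosTerm x (toℕ k)) - y in (- δ < d) × (d < δ)

  -- π / 2 is the least positive zero of the cosine.
  IsHalfPi : ℝ → Set
  IsHalfPi h = 0# < h × IsCos h 0# × (∀ x → 0# < x → x < h → ¬ IsCos x 0#)

  IsPi : ℝ → Set
  IsPi p = ∃[ h ] IsHalfPi h × p ≈ h + h

------------------------------------------------------------------------
-- Transitive colorings of a set of vectors in a real vector space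

module TransitiveColorings
  (R : RealNumbers) {m ℓm : Level}
  (V : Module (RealNumbers.commutativeRing R) m ℓm)
  where

  open RealNumbers R using (ℝ; _<_; 0#)
  open Module V using (Carrierᴹ; _≈ᴹ_; _*ₗ_; ≈ᴹ-setoid; +ᴹ-rawMonoid)
  open RawMonoidDefs +ᴹ-rawMonoid using () renaming (sum to sumᴹ)

  Elements : Pred Carrierᴹ ℓ → Setoid (m ⊔ ℓ) ℓm
  Elements E = On.setoid {B = Σ Carrierᴹ E} ≈ᴹ-setoid proj₁

  InPositiveSpan : List Carrierᴹ → Carrierᴹ → Set ℓm
  InPositiveSpan S v = Σ[ a ∈ Vector ℝ (length S) ]
    (∀ i → 0# < a i) × v ≈ᴹ sumᴹ (λ i → a i *ₗ lookup S i)

  module _ (E : Pred Carrierᴹ ℓ) where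
    open Setoid (Elements E) using () renaming (Carrier to Elem)
    open Membership (Elements E) using (_∈_)
    open DisjointLists (Elements E) using (Disjoint)
    open UniqueLists (Elements E) using (Unique)

    -- A coloring is a function on vectors, i.e. it respects ≈ᴹ.
    Coloring : Set → Set (m ⊔ ℓ ⊔ ℓm)
    Coloring C = Elements E ⟶ₛ ≡.setoid C

    -- Subsets of the finite set E are given as duplicate-free lists.
    IsTransitive : {C : Set} → Coloring C → Set (m ⊔ ℓ ⊔ ℓm)
    IsTransitive ε = (S T : List Elem) → Unique S → Unique T →
      S ≢ [] → T ≢ [] → Disjoint S T →
      (∃[ v ] InPositiveSpan (map proj₁ S) v × InPositiveSpan (map proj₁ T) v) →
      ∃[ s ] ∃[ t ] s ∈ S × t ∈ T × Func.to ε s ≡ Func.to ε t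

    -- |ε(E)| = k
    UsesColors : {C : Set} → Coloring C → ℕ → Set (m ⊔ ℓ)
    UsesColors {C = C} ε k = Σ[ f ∈ (Fin k → C) ] Injective _≡_ _≡_ f ×
      (∀ x → (∃[ i ] f i ≡ x) ⇔ (∃[ e ] Func.to ε e ≡ x))

    TransitivelyColorableWith : ℕ → Set (lsuc 0ℓ ⊔ m ⊔ ℓ ⊔ ℓm)
    TransitivelyColorableWith k =
      Σ[ C ∈ Set ] Σ[ ε ∈ Coloring C ] IsTransitive ε × UsesColors ε k

------------------------------------------------------------------------
-- Coxeter groups

-- The entry m(i,j) = ∞ is encoded as 0.
record CoxeterMatrix (n : ℕ) : Set where
  field
    m         : Fin n → Fin n → ℕ
    symmetric : ∀ i j → m i j ≡ m j i
    diagonal  : ∀ i → m i i ≡ 1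
    off-diag  : ∀ i j → i ≢ j → m i j ≢ 1

  -- (i j)^m(i,j); the empty word when m(i,j) = ∞.
  relator : Fin n → Fin n → List (Fin n)
  relator i j = concat (replicate (m i j) (i ∷ j ∷ []))

  -- The relators with i = j make the generators involutions, so that the
  -- monoid presentation by words in the generators is the group
  -- presentation ⟨ sᵢ ∣ (sᵢ sⱼ)^m(i,j) = 1 ⟩.
  data Deletion : Rel (List (Fin n)) 0ℓ where
    delete : ∀ u i j v → Deletion (u ++ relator i j ++ v) (u ++ v)

  infix 4 _∼_
  _∼_ : Rel (List (Fin n)) 0ℓ
  _∼_ = EqClosure Deletion

record CoxeterSystem (W : Group c ℓ) : Set (c ⊔ ℓ) where
  open Group W
  field
    rank          : ℕ
    coxeterMatrix : CoxeterMatrix rank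
    s             : Fin rank → Carrier

  open CoxeterMatrix coxeterMatrix public

  eval : List (Fin rank) → Carrier
  eval = foldr (λ i w → s i ∙ w) ε

  field
    generates    : ∀ w → ∃[ u ] eval u ≈ w
    presentation : ∀ u v → eval u ≈ eval v ⇔ u ∼ v

------------------------------------------------------------------------
-- The geometric representation and its positive roots

coordinateSpace : (R : RealNumbers) → ℕ → Module (RealNumbers.commutativeRing R) 0ℓ 0ℓ
coordinateSpace R n = record
  { Carrierᴹ = Vector ℝ n
  ; _≈ᴹ_     = λ u v → ∀ i → u i ≈ v i
  ; _+ᴹ_     = λ u v i → u i + v i
  ; _*ₗ_     = λ x v i → x * v i
  ; _*ᵣ_     = λ v x i → v i * x
  ; 0ᴹ       = λ _ → 0#
  ; -ᴹ_      = λ v i → - v i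
  ; isModule = record
    { isBimodule = record
      { isBisemimodule = record
        { +ᴹ-isCommutativeMonoid = record
          { isMonoid = record
            { isSemigroup = record
              { isMagma = record
                { isEquivalence = record
                  { refl  = λ _ → refl
                  ; sym   = λ p i → sym (p i)
                  ; trans = λ p q i → trans (p i) (q i)
                  }
                ; ∙-cong = λ p q i → +-cong (p i) (q i)
                }
              ; assoc = λ u v w i → +-assoc (u i) (v i) (w i)
              }
            ; identity = (λ v i → +-identityˡ (v i)) , (λ v i → +-identityʳ (v i))
            }
          ; comm = λ u v i → +-comm (u i) (v i)
          }
        ; isPreleftSemimodule = record
          { *ₗ-cong      = λ p q i → *-cong p (q i)
          ; *ₗ-zeroˡ     = λ v i → zeroˡ (v i)
          ; *ₗ-distribʳ  = λ v x y i → distribʳ (v i) x y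
          ; *ₗ-identityˡ = λ v i → *-identityˡ (v i)
          ; *ₗ-assoc     = λ x y v i → *-assoc x y (v i)
          ; *ₗ-zeroʳ     = λ x i → zeroʳ x
          ; *ₗ-distribˡ  = λ x u v i → distribˡ x (u i) (v i)
          }
        ; isPrerightSemimodule = record
          { *ᵣ-cong      = λ p q i → *-cong (p i) q
          ; *ᵣ-zeroʳ     = λ v i → zeroʳ (v i)
          ; *ᵣ-distribˡ  = λ v x y i → distribˡ (v i) x y
          ; *ᵣ-identityʳ = λ v i → *-identityʳ (v i)
          ; *ᵣ-assoc     = λ v x y i → *-assoc (v i) x y
          ; *ᵣ-zeroˡ     = λ x i → zeroˡ x
          ; *ᵣ-distribʳ  = λ x u v i → distribʳ x (u i) (v i)
          }
        ; *ₗ-*ᵣ-assoc = λ x v y i → *-assoc x (v i) y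
        }
      ; -ᴹ‿cong    = λ p i → -‿cong (p i)
      ; -ᴹ‿inverse = (λ v i → -‿inverseˡ (v i)) , (λ v i → -‿inverseʳ (v i))
      }
    ; *ₗ-*ᵣ-coincident = λ x v i → *-comm x (v i)
    }
  }
  where open RealNumbers R

-- The matrix B(αᵢ, αⱼ) = - cos (π / m(i,j)).  The diagonal entries are
-- - cos (π / 1) = 1, and those with m(i,j) = ∞ are - cos 0 = -1.
record GramMatrix (R : RealNumbers) {n : ℕ} (M : CoxeterMatrix n) : Set where
  open RealNumbers R
  open Cosine R
  open CoxeterMatrix M
  field
    π     : ℝ
    isPi  : IsPi π
    gram  : Fin n → Fin n → ℝ
    gram-diagonal : ∀ i → gram i i ≈ 1#
    gram-finite   : ∀ i j → i ≢ j → m i j ≢ 0 →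
                    IsCos (π * (m i j · 1#) ⁻¹) (- gram i j)
    gram-infinite : ∀ i j → m i j ≡ 0 → gram i j ≈ - 1#

module Geometric
  (R : RealNumbers) {W : Group c ℓ} (cox : CoxeterSystem W)
  (G : GramMatrix R (CoxeterSystem.coxeterMatrix cox))
  where

  open RealNumbers R hiding (_≈_)
  open CoxeterSystem cox
  open GramMatrix G
  open Group W using () renaming (Carrier to ∣W∣; _≈_ to _≈ᵂ_)

  space : Module commutativeRing 0ℓ 0ℓ
  space = coordinateSpace R rank

  open Module space using (Carrierᴹ; _≈ᴹ_; _+ᴹ_; -ᴹ_; _*ₗ_)

  α : Fin rank → Carrierᴹ
  α i j = if does (i ≟ j) then 1# else 0#

  B : Carrierᴹ → Carrierᴹ → ℝ
  B u v = sum (λ i → sum (λ j → u i * gram i j * v j))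

  σ : Fin rank → Carrierᴹ → Carrierᴹ
  σ i v = v +ᴹ (-ᴹ (((1# + 1#) * B (α i) v) *ₗ α i))

  -- w v ≈ v′ in the geometric representation of W, the action of w being
  -- computed along an expression of w in the generators.
  _[_]↦_ : ∣W∣ → Carrierᴹ → Carrierᴹ → Set ℓ
  w [ v ]↦ v′ = ∃[ u ] eval u ≈ᵂ w × v′ ≈ᴹ foldr σ v u

  IsRoot : Pred Carrierᴹ (c ⊔ ℓ)
  IsRoot β = ∃[ w ] ∃[ i ] w [ α i ]↦ β

  IsPositiveRoot : Pred Carrierᴹ (c ⊔ ℓ)
  IsPositiveRoot β = IsRoot β × (∀ i → 0# ≤ β i)

{-# OPTIONS --safe #-}

-- The simple roots already carry every color: a positive root β that is not
-- simple is a positive combination of the simple roots in its support, and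
-- transitivity applied to {β} and this support gives β the color of a simple
-- root.  So there are at most rank-many colors.  Conversely, color a positive
-- root by the first index at which its coordinate is nonzero.  A vector in the
-- positive span of S has the least color of S as its first nonzero index, so
-- if it is also in the positive span of T then S and T share that color.

module Submission where

open import Defs
open import Algebra.Bundles using (Group)
open import Algebra.Module.Bundles using (Module)
import Algebra.Definitions.RawMonoid as RawMonoidDefs
import Algebra.Properties.AbelianGroup as AbelianGroupProperties
open import Data.Empty using (⊥-elim)
open import Data.Fin.Base as Fin using (Fin; zero; suc)
open import Data.Fin.Properties as Fin
  using (_≟_; <-cmp; any?; all?; injective⇒≤; suc-injective; 0≢1+n)
open import Data.List.Base using (List; []; _∷_; foldr; lookup; map)
import Data.List.Membership.Setoid as Membership
open import Data.List.Relation.Unary.All as All using (All; []; _∷_)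
open import Data.List.Relation.Unary.AllPairs using ([]; _∷_)
open import Data.List.Relation.Unary.Any using (here; there)
import Data.List.Relation.Unary.Unique.Setoid as UniqueLists
open import Data.Nat.Base as ℕ using (ℕ; s<s)
open import Data.Product.Base using (∃; ∃-syntax; _×_; _,_; proj₁; proj₂)
open import Data.Sum.Base using (inj₁; inj₂)
open import Data.Vec.Functional using (Vector)
open import Function.Base using (_∘_; id)
open import Function.Bundles using (Func; mk⇔; module Equivalence)
open import Level using (Level)
open import Relation.Binary.Bundles using (Setoid)
open import Relation.Binary.Definitions using (Decidable; tri<; tri≈; tri>)
open import Relation.Binary.PropositionalEquality as ≡ using (_≡_; _≢_)
open import Relation.Binary.Structures using (IsStrictTotalOrder)
import Relation.Binary.Reasoning.Setoid as SetoidReasoning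
open import Relation.Nullary using (¬_; yes; no)
open import Relation.Unary using (Pred)

private
  variable
    c ℓ m ℓm : Level
    n : ℕ

-- Ordered-field facts and sums with at most one nonzero term.

module RealProperties (R : RealNumbers) where
  open RealNumbers R hiding (zero)
  open IsStrictTotalOrder isStrictTotalOrder public
    using (<-respʳ-≈; <-respˡ-≈; irrefl) renaming (_≟_ to _≈?_; trans to <-trans)

  +-pos : ∀ {x y} → 0# < x → 0# < y → 0# < x + y
  +-pos {x} {y} 0<x 0<y =
    <-trans 0<y (<-respˡ-≈ (+-identityˡ y) (+-monoˡ-< y 0<x))

  1≉0 : ¬ (1# ≈ 0#)
  1≉0 1≈0 = irrefl (sym 1≈0) 0<1

  sum-zero : {f : Vector ℝ n} → (∀ i → f i ≈ 0#) → sum f ≈ 0#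
  sum-zero {ℕ.zero}  f≈0 = refl
  sum-zero {ℕ.suc n} f≈0 =
    trans (+-cong (f≈0 zero) (sum-zero (f≈0 ∘ suc))) (+-identityˡ 0#)

  sum-single : {f : Vector ℝ n} (i : Fin n) → (∀ j → j ≢ i → f j ≈ 0#) → sum f ≈ f i
  sum-single zero    f≈0 =
    trans (+-congˡ (sum-zero λ j → f≈0 (suc j) λ ())) (+-identityʳ _)
  sum-single (suc i) f≈0 =
    trans (+-cong (f≈0 zero λ ()) (sum-single i λ j j≢i → f≈0 (suc j) (j≢i ∘ suc-injective)))
          (+-identityˡ _)

-- Upper bound: a family whose cone contains `E` carries every color.

module ColorBounds (R : RealNumbers) (V : Module (RealNumbers.commutativeRing R) m ℓm)
  (E : Pred (Module.Carrierᴹ V) ℓ) where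

  open RealNumbers R using (ℝ; _<_; _≤_; 0#; 1#; 0<1)
  open RealProperties R
  open Module V
  open RawMonoidDefs +ᴹ-rawMonoid using () renaming (sum to sumᴹ)
  open TransitiveColorings R V
  open Setoid (Elements E) using () renaming (Carrier to Elem; _≈_ to _≈ᴱ_)
  open UniqueLists (Elements E) using (Unique)
  open Membership (Elements E) using (_∈_)

  combination : Vector ℝ n → (Fin n → Elem) → Carrierᴹ
  combination a γ = sumᴹ (λ i → a i *ₗ proj₁ (γ i))

  -- Transitivity speaks of strictly positive coefficients, while conical expansions only give
  -- nonnegative ones. Dropping the zero terms leaves the value unchanged, and injectivity of `γ`
  -- keeps the remaining list duplicate-free.
  support : (γ : Fin n → Elem) → (∀ {i j} → γ i ≈ᴱ γ j → i ≡ j) →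
            (a : Vector ℝ n) → (∀ i → 0# ≤ a i) →
            ∃[ T ] Unique T × All (λ t → ∃[ i ] t ≡ γ i) T ×
              InPositiveSpan (map proj₁ T) (combination a γ)
  support {ℕ.zero}  γ inj a a≥0 = [] , [] , [] , (λ ()) , (λ ()) , ≈ᴹ-refl
  support {ℕ.suc n} γ inj a a≥0
    with support (γ ∘ suc) (λ e → suc-injective (inj e)) (a ∘ suc) (a≥0 ∘ suc) | a≥0 zero
  ... | T , uniq , img , b , b>0 , eq | inj₁ 0<a₀ =
    γ zero ∷ T ,
    All.map (λ { (i , ≡.refl) e → 0≢1+n (inj e) }) img ∷ uniq ,
    (zero , ≡.refl) ∷ All.map (λ (i , e) → suc i , e) img ,
    (λ { zero → a zero ; (suc i) → b i }) ,
    (λ { zero → 0<a₀ ; (suc i) → b>0 i }) ,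
    +ᴹ-congˡ eq
  ... | T , uniq , img , b , b>0 , eq | inj₂ 0≈a₀ =
    T , uniq , All.map (λ (i , e) → suc i , e) img , b , b>0 ,
    ≈ᴹ-trans (+ᴹ-congʳ (≈ᴹ-trans (*ₗ-congʳ (RealNumbers.sym R 0≈a₀)) (*ₗ-zeroˡ _)))
      (≈ᴹ-trans (+ᴹ-identityˡ _) eq)

  module _
    (_≈ᴹ?_ : Decidable _≈ᴹ_)
    (γ : Fin n → Elem) (γ-injective : ∀ {i j} → γ i ≈ᴱ γ j → i ≡ j)
    (nonzero : ∀ (e : Elem) → ¬ (proj₁ e ≈ᴹ 0ᴹ))
    (conical : ∀ (e : Elem) → ∃[ a ] (∀ i → 0# ≤ a i) × proj₁ e ≈ᴹ combination a γ)
    where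

    -- Transitivity is applied to `e ∷ []` against the support of `e`: the left side offers only the
    -- color of `e`, and the right side consists of generators.
    color-of-generator : ∀ {C} (ε : Coloring E C) → IsTransitive E ε →
                         ∀ e → ∃[ i ] Func.to ε e ≡ Func.to ε (γ i)
    -- An `e` equal to some generator is settled at once; otherwise `e` lies outside its own
    -- support, which gives the disjointness.
    color-of-generator ε transitive e with any? (λ i → proj₁ e ≈ᴹ? proj₁ (γ i))
    ... | yes (i , e≈γi) = i , Func.cong ε e≈γi
    ... | no e≉γ =
      let a , a≥0 , e≈        = conical e
          T , uniq , img , sp = support γ γ-injective a a≥0
          s , t , s∈ , t∈ , q = transitive (e ∷ []) T ([] ∷ []) uniq (λ ())
            -- An empty support would span only `0ᴹ`. The common vector is `e` itself, with
            -- coefficient `1#` on the left.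
            (nonempty T (nonzero e ∘ ≈ᴹ-trans e≈) sp) (λ {t} → disjoint t img)
            (proj₁ e , ((λ _ → 1#) , (λ { zero → 0<1 }) ,
              ≈ᴹ-sym (≈ᴹ-trans (+ᴹ-identityʳ _) (*ₗ-identityˡ _))) ,
              (proj₁ sp , proj₁ (proj₂ sp) , ≈ᴹ-trans e≈ (proj₂ (proj₂ sp))))
          i , t≈γi = generator t img t∈
      in i , ≡.trans (Func.cong ε (≈ᴹ-sym (head s e s∈))) (≡.trans q (Func.cong ε t≈γi))
      where
      head : ∀ x y → x ∈ y ∷ [] → x ≈ᴱ y
      head _ _ (here p) = p

      nonempty : ∀ T {v} → ¬ (v ≈ᴹ 0ᴹ) → InPositiveSpan (map proj₁ T) v → T ≢ []
      nonempty _ v≉0 (_ , _ , v≈0) ≡.refl = v≉0 v≈0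

      generator : ∀ {T} t → All (λ t → ∃[ i ] t ≡ γ i) T → t ∈ T → ∃[ i ] t ≈ᴱ γ i
      generator _ ((i , ≡.refl) ∷ _) (here p)  = i , p
      generator t (_ ∷ img)          (there p) = generator t img p

      disjoint : ∀ {T} t → All (λ t → ∃[ i ] t ≡ γ i) T → ¬ (t ∈ e ∷ [] × t ∈ T)
      disjoint t img (p , q) =
        let i , t≈γi = generator t img q in e≉γ (i , ≈ᴹ-trans (≈ᴹ-sym (head t e p)) t≈γi)

    -- Choosing for each color a generator that bears it is injective, since a generator has only
    -- one color.
    colors≤generators : ∀ k → TransitivelyColorableWith E k → k ℕ.≤ n
    colors≤generators k (C , ε , transitive , f , f-injective , image) =
      injective⇒≤ {f = proj₁ ∘ index} λ {i} {j} eq → f-injective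
        (≡.trans (≡.sym (proj₂ (index i)))
          (≡.trans (≡.cong (Func.to ε ∘ γ) eq) (proj₂ (index j))))
      where
      index : ∀ i → ∃[ j ] Func.to ε (γ j) ≡ f i
      index i =
        let e , εe≡fi   = Equivalence.to (image (f i)) (i , ≡.refl)
            j , εe≡εγj = color-of-generator ε transitive e
        in j , ≡.trans (≡.sym εe≡εγj) εe≡fi

-- Lower bound: coloring by the first nonzero coordinate.

module LeadingIndices (R : RealNumbers) where
  open RealNumbers R hiding (zero)
  open RealProperties R

  -- The leading entry is required to be positive, not merely nonzero, so that leading entries
  -- cannot cancel in a positive combination.
  IsLead : Vector ℝ n → Fin n → Set
  IsLead v i = 0# < v i × (∀ j → j Fin.< i → v j ≈ 0#)

  lead : (v : Vector ℝ n) → (∀ i → 0# ≤ v i) → ¬ (∀ i → v i ≈ 0#) → ∃ (IsLead v)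
  lead {ℕ.zero}  v v≥0 v≉0 = ⊥-elim (v≉0 λ ())
  lead {ℕ.suc n} v v≥0 v≉0 with v≥0 zero
  ... | inj₁ 0<v₀ = zero , 0<v₀ , λ _ ()
  ... | inj₂ 0≈v₀ =
    let i , 0<vᵢ , before = lead (v ∘ suc) (v≥0 ∘ suc)
                              (λ v≈0 → v≉0 λ { zero → sym 0≈v₀ ; (suc j) → v≈0 j })
    in suc i , 0<vᵢ , λ { zero _ → sym 0≈v₀ ; (suc j) (s<s j<i) → before j j<i }

  -- If the leads differed, the entry at the smaller one would be both positive and zero. Allowing
  -- `u` and `v` to be merely equal up to `≈` makes this also the congruence proof of the coloring.
  lead-unique : {u v : Vector ℝ n} {i j : Fin n} → (∀ k → u k ≈ v k) →
                IsLead u i → IsLead v j → i ≡ j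
  lead-unique {i = i} {j} u≈v (0<uᵢ , u≈0) (0<vⱼ , v≈0) with <-cmp i j
  ... | tri< i<j _ _ = ⊥-elim (irrefl (sym (trans (u≈v i) (v≈0 i i<j))) 0<uᵢ)
  ... | tri≈ _ i≡j _ = i≡j
  ... | tri> _ _ j<i = ⊥-elim (irrefl (sym (trans (sym (u≈v j)) (u≈0 j j<i))) 0<vⱼ)

  lead-scale : ∀ {a} {v : Vector ℝ n} {i} → 0# < a → IsLead v i → IsLead (λ k → a * v k) i
  lead-scale 0<a (0<vᵢ , v≈0) =
    *-pos 0<a 0<vᵢ , λ j j<i → trans (*-congˡ (v≈0 j j<i)) (zeroʳ _)

  module LeadColoring {n : ℕ} (E : Pred (Vector ℝ n) ℓ)
    (leads : (e : ∃ E) → ∃ (IsLead (proj₁ e))) where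

    space : Module commutativeRing _ _
    space = coordinateSpace R n

    open Module space using (_*ₗ_; +ᴹ-rawMonoid; ≈ᴹ-refl)
    open RawMonoidDefs +ᴹ-rawMonoid using () renaming (sum to sumᴹ)
    open TransitiveColorings R space
    open Membership (Elements E) using (_∈_)

    leadColoring : Coloring E (Fin n)
    leadColoring = record
      { to   = proj₁ ∘ leads
      ; cong = λ {x} {y} x≈y → lead-unique x≈y (proj₂ (leads x)) (proj₂ (leads y))
      }

    -- The lead of a sum is the smaller of the two leads, by induction along the list. The list is
    -- kept nonempty because the empty sum has no lead.
    lead-of-span : ∀ x S {v} → InPositiveSpan (map proj₁ (x ∷ S)) v →
                   ∃[ s ] s ∈ x ∷ S × IsLead v (proj₁ (leads s))
    lead-of-span x S {v} (a , a>0 , v≈) =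
      let s , s∈ , l = go x S a a>0
      in s , s∈ , <-respʳ-≈ (sym (v≈ _)) (proj₁ l) , λ j j<i → trans (v≈ j) (proj₂ l j j<i)
      where
      go : ∀ x S (a : Vector ℝ _) → (∀ i → 0# < a i) →
           ∃[ s ] s ∈ x ∷ S ×
             IsLead (sumᴹ (λ i → a i *ₗ lookup (map proj₁ (x ∷ S)) i)) (proj₁ (leads s))
      go x [] a a>0 =
        let l = lead-scale (a>0 zero) (proj₂ (leads x))
        in x , here ≈ᴹ-refl , <-respʳ-≈ (sym (+-identityʳ _)) (proj₁ l) ,
           λ j j<i → trans (+-identityʳ _) (proj₂ l j j<i)
      go x (y ∷ S) a a>0
        with lead-scale (a>0 zero) (proj₂ (leads x)) | go y S (a ∘ suc) (a>0 ∘ suc)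
      ... | 0<x , x≈0 | s , s∈ , 0<s , s≈0 with <-cmp (proj₁ (leads x)) (proj₁ (leads s))
      -- When the leads differ, the summand with the later lead vanishes at the earlier one, so the
      -- earlier leading entry survives unchanged.
      ... | tri< i<j _ _ = x , here ≈ᴹ-refl ,
        <-respʳ-≈ (trans (sym (+-identityʳ _)) (+-congˡ (sym (s≈0 _ i<j)))) 0<x ,
        λ k k<i → trans (+-cong (x≈0 k k<i) (s≈0 k (Fin.<-trans k<i i<j)))
                        (+-identityʳ _)
      -- When the leads agree, two positive entries add up. Either vector could serve as witness;
      -- the one from the tail is kept.
      ... | tri≈ _ i≡j _ = s , there s∈ ,
        +-pos (≡.subst (λ i → 0# < a zero * proj₁ x i) i≡j 0<x) 0<s ,
        λ k k<j → trans (+-cong (x≈0 k (≡.subst (k Fin.<_) (≡.sym i≡j) k<j)) (s≈0 k k<j))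
                        (+-identityʳ _)
      ... | tri> _ _ j<i = s , there s∈ ,
        <-respʳ-≈ (trans (sym (+-identityˡ _)) (+-congʳ (sym (x≈0 _ j<i)))) 0<s ,
        λ k k<j → trans (+-cong (x≈0 k (Fin.<-trans k<j j<i)) (s≈0 k k<j))
                        (+-identityʳ _)

    leadColoring-transitive : IsTransitive E leadColoring
    leadColoring-transitive [] _ _ _ S≢[] = ⊥-elim (S≢[] ≡.refl)
    leadColoring-transitive (_ ∷ _) [] _ _ _ T≢[] = ⊥-elim (T≢[] ≡.refl)
    leadColoring-transitive (x ∷ S) (y ∷ T) _ _ _ _ _ (v , v∈S , v∈T) =
      let s , s∈ , ls = lead-of-span x S v∈S
          t , t∈ , lt = lead-of-span y T v∈T
      in s , t , s∈ , t∈ , lead-unique (λ _ → refl) ls lt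

-- Simple roots as the standard basis, and nonvanishing of roots.

module RootProperties
  (R : RealNumbers) {W : Group c ℓ} (cox : CoxeterSystem W)
  (G : GramMatrix R (CoxeterSystem.coxeterMatrix cox)) where

  open RealNumbers R hiding (zero)
  open RealProperties R
  open CoxeterSystem cox using (rank)
  open GramMatrix G
  open Geometric R cox G
  open Module space using (_≈ᴹ_; 0ᴹ; +ᴹ-rawMonoid; _*ₗ_)
  open RawMonoidDefs +ᴹ-rawMonoid using () renaming (sum to sumᴹ)
  open AbelianGroupProperties +-abelianGroup using (xyx⁻¹≈y; x∙y⁻¹≈ε⇒x≈y)
  open LeadingIndices R

  α-diagonal : ∀ i → α i i ≈ 1#
  α-diagonal i with i ≟ i
  ... | yes _  = refl
  ... | no i≢i = ⊥-elim (i≢i ≡.refl)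

  α-off-diagonal : ∀ {i j} → i ≢ j → α i j ≈ 0#
  α-off-diagonal {i} {j} i≢j with i ≟ j
  ... | yes i≡j = ⊥-elim (i≢j i≡j)
  ... | no _    = refl

  α-injective : ∀ {i j} → α i ≈ᴹ α j → i ≡ j
  α-injective {i} {j} αᵢ≈αⱼ with i ≟ j
  ... | yes i≡j = i≡j
  ... | no i≢j  = ⊥-elim (1≉0
    (trans (sym (α-diagonal j)) (trans (sym (αᵢ≈αⱼ j)) (α-off-diagonal i≢j))))

  α-nonneg : ∀ i j → 0# ≤ α i j
  α-nonneg i j with i ≟ j
  ... | yes _ = inj₁ 0<1
  ... | no _  = inj₂ refl

  α-root : ∀ i → IsPositiveRoot (α i)
  α-root i = (Group.ε W , i , [] , Group.refl W , λ _ → refl) , α-nonneg i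

  α-lead : ∀ i → IsLead (α i) i
  α-lead i = <-respʳ-≈ (sym (α-diagonal i)) 0<1 ,
    λ j j<i → α-off-diagonal λ i≡j → Fin.<-irrefl (≡.sym i≡j) j<i

  -- The coefficients are the coordinates themselves, so the sign condition in `IsPositiveRoot` is
  -- exactly what makes this expansion conical.
  α-combination : ∀ v → v ≈ᴹ sumᴹ (λ i → v i *ₗ α i)
  α-combination v j = sym (trans (pointwise (λ i → v i *ₗ α i))
    (trans (sum-single j λ i i≢j → trans (*-congˡ (α-off-diagonal i≢j)) (zeroʳ _))
           (trans (*-congˡ (α-diagonal j)) (*-identityʳ _))))
    where
    pointwise : ∀ {k} (f : Fin k → Vector ℝ rank) → sumᴹ f j ≈ sum (λ i → f i j)
    pointwise {ℕ.zero}  f = refl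
    pointwise {ℕ.suc k} f = +-congˡ (pointwise (f ∘ suc))

  -- Only the `(i , i)` term of the double sum survives, and `gram i i` is `1#`. This handles a
  -- vector in the kernel of `σ i`, which must lie on the line of `α i`.
  B-on-line : ∀ i t {v} → v ≈ᴹ t *ₗ α i → B (α i) v ≈ t
  B-on-line i t {v} v≈tα = begin
    B (α i) v                           ≈⟨ sum-single i off-row ⟩
    sum (λ b → α i i * gram i b * v b)  ≈⟨ sum-single i off-column ⟩
    α i i * gram i i * v i              ≈⟨ *-cong (*-cong (α-diagonal i) (gram-diagonal i))
                                             (trans (v≈tα i) (*-congˡ (α-diagonal i))) ⟩
    1# * 1# * (t * 1#)                  ≈⟨ *-cong (*-identityˡ 1#) (*-identityʳ t) ⟩
    1# * t                              ≈⟨ *-identityˡ t ⟩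
    t                                   ∎
    where
    open SetoidReasoning setoid

    off-row : ∀ a → a ≢ i → sum (λ b → α i a * gram a b * v b) ≈ 0#
    off-row a a≢i = sum-zero {n = rank} λ b →
      trans (*-congʳ (trans (*-congʳ (α-off-diagonal (a≢i ∘ ≡.sym))) (zeroˡ _))) (zeroˡ _)

    off-column : ∀ b → b ≢ i → α i i * gram i b * v b ≈ 0#
    off-column b b≢i = trans (*-congˡ (trans (v≈tα b)
      (trans (*-congˡ (α-off-diagonal (b≢i ∘ ≡.sym))) (zeroʳ t)))) (zeroʳ _)

  -- If σᵢ v = 0 then v = t αᵢ with t = 2 B(αᵢ, v) = 2 t.
  σ-nonzero : ∀ i {v} → ¬ (v ≈ᴹ 0ᴹ) → ¬ (σ i v ≈ᴹ 0ᴹ)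
  σ-nonzero i {v} v≉0 σv≈0 = v≉0 λ j →
    trans (v≈tα j) (trans (*-congʳ t≈0) (zeroˡ _))
    where
    t = (1# + 1#) * B (α i) v

    v≈tα : v ≈ᴹ t *ₗ α i
    v≈tα j = x∙y⁻¹≈ε⇒x≈y (v j) (t * α i j) (σv≈0 j)

    t≈t+t : t ≈ t + t
    t≈t+t = trans (*-congˡ (B-on-line i t v≈tα))
      (trans (distribʳ t 1# 1#) (+-cong (*-identityˡ t) (*-identityˡ t)))

    t≈0 : t ≈ 0#
    t≈0 = trans (sym (xyx⁻¹≈y t t)) (trans (+-congʳ (sym t≈t+t)) (-‿inverseʳ t))

  -- Each reflection in the word preserves nonvanishing, and the word starts from a simple root,
  -- which has a coordinate `1#`. Both bounds rely on this: a positive root has a lead and a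
  -- nonempty support.
  root-nonzero : ∀ {β} → IsRoot β → ¬ (β ≈ᴹ 0ᴹ)
  root-nonzero (_ , i , u , _ , β≈) β≈0 = go u λ j → trans (sym (β≈ j)) (β≈0 j)
    where
    go : ∀ u → ¬ (foldr σ (α i) u ≈ᴹ 0ᴹ)
    go []      α≈0 = 1≉0 (trans (sym (α-diagonal i)) (α≈0 i))
    go (j ∷ u) σ≈0 = σ-nonzero j (go u) σ≈0

corollary1p12 : ∀ {c ℓ} (W : Group c ℓ) (cox : CoxeterSystem W) →
    Finite (Group.setoid W) →
    (R : RealNumbers) (G : GramMatrix R (CoxeterSystem.coxeterMatrix cox)) →
    let open Geometric R cox G
        open TransitiveColorings R space in
    IsMaximum (TransitivelyColorableWith IsPositiveRoot) (CoxeterSystem.rank cox)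
corollary1p12 W cox _ R G =
  -- The colors are the indices themselves, enumerated by `id`; all of them occur because `α i` has
  -- lead `i`.
  (Fin rank , leadColoring , leadColoring-transitive , id , id ,
    λ x → mk⇔ (λ _ → simpleRoot x ,
                lead-unique (λ _ → refl) (proj₂ (leads (simpleRoot x))) (α-lead x))
              (λ _ → x , ≡.refl)) ,
  -- Equality of vectors is decided coordinatewise, by trichotomy of the order on the reals.
  colors≤generators (λ u v → all? λ i → u i ≈? v i)
    simpleRoot α-injective (λ (_ , root , _) → root-nonzero root)
    (λ (β , _ , β≥0) → β , β≥0 , α-combination β)
  where
  open CoxeterSystem cox using (rank)
  open RealNumbers R using (refl)
  open RealProperties R using (_≈?_)
  open Geometric R cox G
  open RootProperties R cox G
  open LeadingIndices R

  simpleRoot : Fin rank → ∃ IsPositiveRoot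
  simpleRoot i = α i , α-root i

  leads : ∀ (e : ∃ IsPositiveRoot) → ∃ (IsLead (proj₁ e))
  leads (β , root , β≥0) = lead β β≥0 (root-nonzero root)

  open LeadColoring IsPositiveRoot leads using (leadColoring; leadColoring-transitive)
  open ColorBounds R space IsPositiveRoot using (colors≤generators)
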